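{- The age of $\omega*I_\omega^*$ has the Ramsey property.
   Context: In a directed graph, write $x\perp y$ iff neither $(x,y)$ nor $(y,x)$ is an edge. $\omega*I_\omega$ is the Fraïssé limit of the class of all finite directed graphs in which $\perp$ is an equivalence relation (the classes are called parts); it consists of countably many disjoint infinite independent parts with all edges between different parts present in one direction. $\omega*I_\omega^*$ is obtained by adding a linear order $<$ convex with respect to the parts, ordering each part densely and the set of parts densely; no unary predicates are added. Its age consists of all finite such directed graphs equipped with a linear order convex with respect to the parts. A class $\mathcal K$ of finite structures has the Ramsey property if for all $k\in\mathbb N$ and $\mathbf A,\mathbf B\in\mathcal K$ there is $\mathbf C\in\mathcal K$ such that for every colouring of the substructures of $\mathbf C$ isomorphic to $\mathbf A$ with $k$ colours there is a substructure $\mathbf B'\cong\mathbf B$ of $\mathbf C$ on whose substructures isomorphic to $\mathbf A$ the colouring is constant. -}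

module Defs where

open import Data.Nat using (ℕ)
open import Data.Fin using (Fin; _<_)
open import Data.Bool using (Bool; true; false)
open import Data.Vec using (Vec; lookup; map)
open import Data.Product using (_×_; Σ; ∃; _,_)
open import Relation.Binary.PropositionalEquality using (_≡_)

-- A finite structure in the language {E, <}: a directed graph on Fin size
-- (edge relation E) together with a linear order.  Up to isomorphism every
-- finite linearly ordered structure lives on Fin n with the natural order of
-- Fin, so the order < is the order of Fin (Data.Fin._<_).
record Str : Set where
  field
    size : ℕ
    E    : Fin size → Fin size → Bool

open Str public

_⊢_⊥_ : (A : Str) → Fin (size A) → Fin (size A) → Set
A ⊢ x ⊥ y = (E A x y ≡ false) × (E A y x ≡ false)

-- Membership in the age of ω*I_ω^*:
--  * directed graph: no loops, and no pair of opposite edges;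
--  * ⊥ is an equivalence relation (reflexivity and symmetry follow from the
--    above, transitivity is required);
--  * the order is convex with respect to the parts (⊥-classes).
InAge : Str → Set
InAge A =
  (∀ x → E A x x ≡ false) ×
  (∀ x y → E A x y ≡ true → E A y x ≡ false) ×
  (∀ x y z → A ⊢ x ⊥ y → A ⊢ y ⊥ z → A ⊢ x ⊥ z) ×
  (∀ x y z → x < y → y < z → A ⊢ x ⊥ z → A ⊢ x ⊥ y)

-- An embedding of A into C, given by its list of values v (v i = image of i):
-- strictly order preserving and preserving edges and non-edges.  Such
-- embeddings correspond bijectively to substructures of C isomorphic to A
-- (because the structures are rigidly ordered).
IsEmb : (A C : Str) → Vec (Fin (size C)) (size A) → Set
IsEmb A C v =
  (∀ i j → i < j → lookup v i < lookup v j) ×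
  (∀ i j → E A i j ≡ E C (lookup v i) (lookup v j))

-- Ramsey property of the class of structures satisfying K.
-- A k-colouring of the copies of A in C is a map χ from (codes of)
-- embeddings A → C to Fin k (its values on non-embeddings are irrelevant).
RamseyProperty : (Str → Set) → Set
RamseyProperty K =
  (k : ℕ) (A B : Str) → K A → K B →
  Σ Str λ C → K C ×
    ((χ : Vec (Fin (size C)) (size A) → Fin k) →
      Σ (Vec (Fin (size C)) (size B)) λ g → IsEmb B C g ×
        (∀ h h' → IsEmb A B h → IsEmb A B h' →
          χ (map (lookup g) h) ≡ χ (map (lookup g) h')))

{-# OPTIONS --safe #-}
module Submission where

-- The partite construction of Nešetřil and Rödl.  First forget the edges: what is
-- left is a convexly ordered equivalence relation, which sits in a T × T grid
-- ordered lexicographically, the rows being the parts, and Ramsey's theorem for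
-- 2|A|-tuples of Fin T makes a colouring of the positions of A in the grid
-- constant on those inside a position of B.  The edges are restored by blowing up
-- every grid point p to a fibre {p} × F.  For one position e of A, the
-- Hales–Jewett theorem over the alphabet of all copies of A lying over e yields a
-- larger system in which the colour of the copies over e is constant; doing this
-- for all e in turn makes the colour of a copy depend on its position only.
-- Because equivalence is pulled back from the grid, each of these systems is
-- automatically in the age.

open import Data.Bool using (Bool; true; false; not; if_then_else_; _xor_)
import Data.Bool.Properties as Bool
open import Data.Fin using (Fin; zero; suc; toℕ; fromℕ<; splitAt; _<_; _≤_; _≟_; _<?_; _↑ˡ_; _↑ʳ_; combine; quotient; remainder; funToFin; finToFun)
import Data.Fin.Properties as Fin
open import Data.List using (List; []; _∷_; length; allFin; cartesianProduct; cartesianProductWith)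
import Data.List as List
open import Data.List.Membership.Propositional using (_∈_)
open import Data.List.Membership.Propositional.Properties using (∈-map⁺; ∈-++⁺ˡ; ∈-++⁺ʳ; ∈-cartesianProduct⁺; ∈-cartesianProductWith⁺; ∈-filter⁺; ∈-filter⁻; ∈-allFin; ∈-lookup)
open import Data.List.Relation.Unary.Any using (here; there; index)
open import Data.List.Relation.Unary.Any.Properties using (lookup-index)
open import Data.Maybe using (Maybe; just; nothing; maybe)
import Data.Maybe as Maybe
open import Data.Nat using (ℕ; zero; suc; _+_; _*_; _^_; z≤n; s≤s; z<s; s<s; s<s⁻¹)
import Data.Nat.Base as ℕ
import Data.Nat.Properties as ℕ
open import Data.Product using (Σ; ∃; _×_; _,_; proj₁; proj₂)
open import Data.Sum using (_⊎_; inj₁; inj₂; [_,_])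
import Data.Sum as Sum
open import Data.Vec using (Vec; []; _∷_; _++_; lookup; map; tabulate; zipWith)
open import Data.Vec.Properties using (lookup-map; lookup-zipWith; lookup∘tabulate; tabulate∘lookup; tabulate-cong; tabulate-∘; lookup-++ˡ; lookup-++ʳ; map-∘; map-cong; map-++)
open import Function using (_∘_; id)
open import Relation.Binary.Definitions using (tri<; tri≈; tri>)
open import Relation.Binary.PropositionalEquality using (_≡_; _≢_; _≗_; refl; sym; trans; cong; cong₂; subst; subst₂; module ≡-Reasoning)
open import Relation.Nullary using (¬_; Dec; yes; no; contradiction)
open import Relation.Nullary.Decidable using (_→-dec_; _×-dec_; decidable-stable)
open import Relation.Unary using (Decidable)

open import Defs

private variable
  k l m n t N : ℕ
  X Y : Set

-- Increasing maps and tuples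

StrictMono : (Fin m → Fin n) → Set
StrictMono f = ∀ i j → i < j → f i < f j

Increasing : Vec (Fin m) n → Set
Increasing v = StrictMono (lookup v)

vec-ext : {v w : Vec X n} → lookup v ≗ lookup w → v ≡ w
vec-ext {v = v} {w} eq =
  trans (sym (tabulate∘lookup v)) (trans (tabulate-cong eq) (tabulate∘lookup w))

map-increasing : {f : Fin m → Fin l} → StrictMono f →
  (v : Vec (Fin m) n) → Increasing v → Increasing (map f v)
map-increasing {f = f} f-mono v v-inc i j i<j =
  subst₂ _<_ (sym (lookup-map i f v)) (sym (lookup-map j f v))
    (f-mono _ _ (v-inc i j i<j))

strictMono-cancel : {f : Fin m → Fin n} → StrictMono f → ∀ i j → f i < f j → i < j
strictMono-cancel {f = f} f-mono i j fi<fj with Fin.<-cmp i j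
... | tri< i<j _ _  = i<j
... | tri≈ _ refl _ = contradiction fi<fj (ℕ.<-irrefl refl)
... | tri> _ _ j<i  = contradiction (f-mono j i j<i) (ℕ.<-asym fi<fj)

strictMono-injective : {f : Fin m → Fin n} → StrictMono f → ∀ i j → f i ≡ f j → i ≡ j
strictMono-injective {f = f} f-mono i j eq with Fin.<-cmp i j
... | tri< i<j _ _ = contradiction (f-mono i j i<j) (ℕ.<-irrefl (cong toℕ eq))
... | tri≈ _ i≡j _ = i≡j
... | tri> _ _ j<i = contradiction (f-mono j i j<i) (ℕ.<-irrefl (cong toℕ (sym eq)))

-- Ramsey's theorem

-- Induction on `s`: the value at `zero` decides which of `p` and `q` drops by one. Keeping `s` a
-- variable tied by an equation lets both recursive calls use the same predecessor.
true-or-false-subset : ∀ s p q → s ≡ p + q → (f : Fin s → Bool) →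
  (Σ (Fin p → Fin s) λ J → StrictMono J × (∀ i → f (J i) ≡ true)) ⊎
  (Σ (Fin q → Fin s) λ J → StrictMono J × (∀ i → f (J i) ≡ false))
true-or-false-subset s zero q _ f = inj₁ ((λ ()) , (λ ()) , (λ ()))
true-or-false-subset s (suc p) zero _ f = inj₂ ((λ ()) , (λ ()) , (λ ()))
true-or-false-subset (suc s) (suc p) (suc q) eq f = go (f zero) refl
  where
  cons : (Fin n → Fin s) → Fin (suc n) → Fin (suc s)
  cons J zero    = zero
  cons J (suc i) = suc (J i)

  cons-mono : {J : Fin n → Fin s} → StrictMono J → StrictMono (cons J)
  cons-mono J-mono zero    (suc j) _   = z<s
  cons-mono J-mono (suc i) (suc j) i<j = s<s (J-mono i j (s<s⁻¹ i<j))

  cons-const : {J : Fin n → Fin s} {b : Bool} → f zero ≡ b →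
    (∀ i → f (suc (J i)) ≡ b) → ∀ i → f (cons J i) ≡ b
  cons-const e₀ e zero    = e₀
  cons-const e₀ e (suc i) = e i

  suc-mono : {J : Fin n → Fin s} → StrictMono J → StrictMono (suc ∘ J)
  suc-mono J-mono i j i<j = s<s (J-mono i j i<j)

  go : ∀ b → f zero ≡ b →
    (Σ (Fin (suc p) → Fin (suc s)) λ J → StrictMono J × (∀ i → f (J i) ≡ true)) ⊎
    (Σ (Fin (suc q) → Fin (suc s)) λ J → StrictMono J × (∀ i → f (J i) ≡ false))
  go true f0 with true-or-false-subset s p (suc q) (ℕ.suc-injective eq) (f ∘ suc)
  ... | inj₁ (J , J-mono , J-true)  = inj₁ (cons J , cons-mono J-mono , cons-const f0 J-true)
  ... | inj₂ (J , J-mono , J-false) = inj₂ (suc ∘ J , suc-mono J-mono , J-false)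
  go false f0 with true-or-false-subset s (suc p) q (trans (ℕ.suc-injective eq) (ℕ.+-suc p q)) (f ∘ suc)
  ... | inj₁ (J , J-mono , J-true)  = inj₁ (suc ∘ J , suc-mono J-mono , J-true)
  ... | inj₂ (J , J-mono , J-false) = inj₂ (cons J , cons-mono J-mono , cons-const f0 J-false)

isZero : Fin (suc k) → Bool
isZero zero    = true
isZero (suc _) = false

isZero-true : (c : Fin (suc k)) → isZero c ≡ true → c ≡ zero
isZero-true zero _ = refl

isZero-false : (c : Fin (suc k)) → isZero c ≡ false → ∃ λ c′ → c ≡ suc c′
isZero-false (suc c) _ = c , refl

monochromatic-subset : ∀ k m → Σ ℕ λ s → (c : Fin s → Fin k) →
  Σ (Fin m → Fin s) λ J → StrictMono J × ∃ λ a → ∀ i → c (J i) ≡ a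
-- A single point has no colouring with zero colours, so the claim is vacuous.
monochromatic-subset zero    m = 1 , λ c → contradiction (c zero) λ ()
monochromatic-subset (suc k) m = m + s , mono
  where
  s = proj₁ (monochromatic-subset k m)
  mono : (c : Fin (m + s) → Fin (suc k)) →
    Σ (Fin m → Fin (m + s)) λ J → StrictMono J × ∃ λ a → ∀ i → c (J i) ≡ a
  mono c with true-or-false-subset (m + s) m s refl (isZero ∘ c)
  ... | inj₁ (J , J-mono , J-true)  = J , J-mono , zero , λ i → isZero-true _ (J-true i)
  ... | inj₂ (J , J-mono , J-false) =
    let pred i = isZero-false (c (J i)) (J-false i)
        J′ , J′-mono , a , eq = proj₂ (monochromatic-subset k m) (proj₁ ∘ pred)
    in J ∘ J′ , (λ i j i<j → J-mono _ _ (J′-mono i j i<j)) , suc a ,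
       λ i → trans (proj₂ (pred (J′ i))) (cong suc (eq i))

unshift : (v : Vec (Fin (suc m)) n) → (∀ i → zero {m} < lookup v i) → ∃ λ w → v ≡ map suc w
unshift []            _   = [] , refl
unshift (zero ∷ v)    pos = contradiction (pos zero) λ ()
unshift (suc x ∷ v)   pos with unshift v (pos ∘ suc)
... | w , refl = x ∷ w , refl

map-suc-increasing⁻ : (w : Vec (Fin m) n) → Increasing (map suc w) → Increasing w
map-suc-increasing⁻ w inc i j i<j =
  s<s⁻¹ (subst₂ _<_ (lookup-map i suc w) (lookup-map j suc w) (inc i j i<j))

tail-increasing : {x : Fin m} {v : Vec (Fin m) n} → Increasing (x ∷ v) → Increasing v
tail-increasing inc i j i<j = inc (suc i) (suc j) (s<s i<j)

Ramsey : (k l m : ℕ) → Set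
Ramsey k l m = Σ ℕ λ T → (χ : Vec (Fin T) l → Fin k) →
  Σ (Fin m → Fin T) λ H → StrictMono H ×
    ∃ λ c → ∀ z → Increasing z → χ (map H z) ≡ c

-- The intermediate stage of the induction on tuple length: the colour may still depend on the least
-- entry, through `c`.
PreRamsey : (k l m : ℕ) → Set
PreRamsey k l m = Σ ℕ λ T → (χ : Vec (Fin T) (suc l) → Fin k) →
  Σ (Fin m → Fin T) λ H → StrictMono H ×
    Σ (Fin m → Fin k) λ c → ∀ x z → Increasing (x ∷ z) → χ (map H (x ∷ z)) ≡ c x

-- The point `zero` is kept, Ramsey's theorem for the shorter tuples gives `T₁` later points whose
-- tuples after `zero` all have one colour, and the recursion selects among those points.
preRamsey : ∀ k l → (∀ m → Ramsey k l m) → ∀ m → PreRamsey k l m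
preRamsey k l R zero    = 0 , λ χ → (λ ()) , (λ ()) , (λ ()) , (λ ())
preRamsey k l R (suc m) = suc T₀ , pre
  where
  T₁ = proj₁ (preRamsey k l R m)
  T₀ = proj₁ (R T₁)
  pre : (χ : Vec (Fin (suc T₀)) (suc l) → Fin k) →
    Σ (Fin (suc m) → Fin (suc T₀)) λ H → StrictMono H ×
      Σ (Fin (suc m) → Fin k) λ c → ∀ x z → Increasing (x ∷ z) → χ (map H (x ∷ z)) ≡ c x
  pre χ with proj₂ (R T₁) (λ v → χ (zero ∷ map suc v))
  ... | H₀ , H₀-mono , c₀ , eq₀ with proj₂ (preRamsey k l R m) (λ v → χ (map (suc ∘ H₀) v))
  ... | H₁ , H₁-mono , c₁ , eq₁ = H , H-mono , c , eq
    where
    H : Fin (suc m) → Fin (suc T₀)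
    H zero    = zero
    H (suc x) = suc (H₀ (H₁ x))

    H-mono : StrictMono H
    H-mono zero    (suc j) _   = z<s
    H-mono (suc i) (suc j) i<j = s<s (H₀-mono _ _ (H₁-mono i j (s<s⁻¹ i<j)))

    c : Fin (suc m) → Fin k
    c zero    = c₀
    c (suc x) = c₁ x

    map-H : (w : Vec (Fin m) n) → map H (map suc w) ≡ map (suc ∘ H₀) (map H₁ w)
    map-H w = trans (sym (map-∘ H suc w)) (map-∘ (suc ∘ H₀) H₁ w)

    positive : ∀ x z → Increasing (x ∷ z) → ∀ i → zero {m} < lookup z i
    positive x z inc i = ℕ.≤-<-trans z≤n (inc zero (suc i) z<s)

    eq : ∀ x z → Increasing (x ∷ z) → χ (map H (x ∷ z)) ≡ c x
    eq x z inc with unshift z (positive x z inc)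
    eq zero    _ inc | w , refl = trans
      (cong (λ v → χ (zero ∷ v)) (trans (map-H w) (map-∘ suc H₀ (map H₁ w))))
      (eq₀ (map H₁ w) (map-increasing H₁-mono w (map-suc-increasing⁻ w (tail-increasing inc))))
    eq (suc x) _ inc | w , refl = trans
      (cong χ (map-H (x ∷ w)))
      (eq₁ x w (map-suc-increasing⁻ (x ∷ w) inc))

ramsey : ∀ k l m → Ramsey k l m
ramsey k zero    m = m , λ χ → id , (λ _ _ i<j → i<j) , χ [] , λ { [] _ → refl }
ramsey k (suc l) m = T , homogeneous
  where
  s = proj₁ (monochromatic-subset k m)
  T = proj₁ (preRamsey k l (ramsey k l) s)
  homogeneous : (χ : Vec (Fin T) (suc l) → Fin k) →
    Σ (Fin m → Fin T) λ H → StrictMono H ×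
      ∃ λ c → ∀ z → Increasing z → χ (map H z) ≡ c
  homogeneous χ =
    let H , H-mono , c , eq = proj₂ (preRamsey k l (ramsey k l) s) χ
        J , J-mono , a , J-const = proj₂ (monochromatic-subset k m) c
    in H ∘ J , (λ i j i<j → H-mono _ _ (J-mono i j i<j)) , a ,
       λ { (x ∷ z) inc → trans (cong χ (map-∘ H J (x ∷ z)))
             (trans (eq (J x) (map J z) (map-increasing J-mono (x ∷ z) inc)) (J-const x)) }

-- Finite enumerations

-- The list may repeat elements, so `code` is only a section of `element`; repetitions merely add
-- vertices to the final structure.
record Enumeration (X : Set) : Set where
  field
    elements : List X
    complete : ∀ x → x ∈ elements

  card : ℕ
  card = length elements

  element : Fin card → X
  element = List.lookup elements

  code : X → Fin card
  code x = index (complete x)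

  element-code : ∀ x → element (code x) ≡ x
  element-code x = sym (lookup-index (complete x))

open Enumeration

enumFin : ∀ n → Enumeration (Fin n)
enumFin n = record { elements = allFin n ; complete = ∈-allFin }

enum× : Enumeration X → Enumeration Y → Enumeration (X × Y)
enum× F G = record
  { elements = cartesianProduct (elements F) (elements G)
  ; complete = λ { (x , y) → ∈-cartesianProduct⁺ (complete F x) (complete G y) } }

enum⊎ : Enumeration X → Enumeration Y → Enumeration (X ⊎ Y)
enum⊎ F G = record
  { elements = List.map inj₁ (elements F) List.++ List.map inj₂ (elements G)
  ; complete = λ { (inj₁ x) → ∈-++⁺ˡ (∈-map⁺ inj₁ (complete F x))
                 ; (inj₂ y) → ∈-++⁺ʳ _ (∈-map⁺ inj₂ (complete G y)) } }

enumVec : Enumeration X → ∀ n → Enumeration (Vec X n)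
enumVec F zero    = record { elements = [] ∷ [] ; complete = λ { [] → here refl } }
enumVec F (suc n) = record
  { elements = cartesianProductWith _∷_ (elements F) (elements (enumVec F n))
  ; complete = λ { (x ∷ v) → ∈-cartesianProductWith⁺ _∷_ (complete F x) (complete (enumVec F n) v) } }

-- Packs a function into a single colour, so that a word can be coloured by the table of colours of
-- all its completions.
tableCode : (F : Enumeration X) → (X → Fin k) → Fin (k ^ card F)
tableCode F f = funToFin (f ∘ element F)

tableCode-injective : (F : Enumeration X) {f g : X → Fin k} →
  tableCode F f ≡ tableCode F g → f ≗ g
tableCode-injective F {f} {g} eq x = begin
  f x                                          ≡⟨ cong f (element-code F x) ⟨
  f (element F (code F x))                     ≡⟨ Fin.finToFun-funToFin (f ∘ element F) (code F x) ⟨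
  finToFun (tableCode F f) (code F x)          ≡⟨ cong (λ a → finToFun a (code F x)) eq ⟩
  finToFun (tableCode F g) (code F x)          ≡⟨ Fin.finToFun-funToFin (g ∘ element F) (code F x) ⟩
  g (element F (code F x))                     ≡⟨ cong g (element-code F x) ⟩
  g x                                          ∎
  where open ≡-Reasoning

-- The Hales–Jewett theorem

-- The moving coordinates of a combinatorial line are those equal to nothing.
Line : Set → ℕ → Set
Line X d = Vec (Maybe X) d

_at_ : {d : ℕ} → Line X d → X → Vec X d
L at x = map (maybe id x) L

Moving : {d : ℕ} → Line X d → Set
Moving L = ∃ λ c → lookup L c ≡ nothing

HalesJewett : (k t : ℕ) → Set
HalesJewett k t = Σ ℕ λ d → (χ : Vec (Fin t) d → Fin k) →
  Σ (Line (Fin t) d) λ L → Moving L × ∃ λ c → ∀ x → χ (L at x) ≡ c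

-- A word over `X ⊎ Fin n` is a combinatorial subspace with `n` variables. Taking `f` to be `just`
-- turns a line of parameters into a line of the ambient cube.
substitute : {d : ℕ} → (X → Y) → Vec (X ⊎ Fin n) d → Vec Y n → Vec Y d
substitute f s u = map [ f , lookup u ] s

-- `suc ∘ collapse` rewrites the letter 0 as 1 and fixes all other letters.
collapse : Fin (suc (suc t)) → Fin (suc t)
collapse zero    = zero
collapse (suc x) = x

-- Shelah's proof: pass to a subspace on which χ does not distinguish the letters
-- 0 and 1, then apply the theorem to the letters other than 0.
Shelah : (k t n : ℕ) → Set
Shelah k t n = Σ ℕ λ d → (χ : Vec (Fin (suc (suc t))) d → Fin k) →
  Σ (Vec (Fin (suc (suc t)) ⊎ Fin n) d) λ s →
    (∀ i → ∃ λ c → lookup s c ≡ inj₂ i) ×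
    (∀ u → χ (substitute id s u) ≡ χ (substitute id s (map (suc ∘ collapse) u)))

-- Two of the n + 1 words 0…01…1 of length n have the same colour.
insensitive-line : (col : Vec (Fin (suc (suc t))) n → Fin n) →
  Σ (Line (Fin (suc (suc t))) n) λ L → Moving L ×
    col (L at zero) ≡ col (L at suc zero)
insensitive-line {t} {n} col = L , (c , L-c) , L-insensitive
  where
  Z = Fin (suc (suc t))

  step : ∀ {P : Set} → Dec P → Z
  step (yes _) = zero
  step (no _)  = suc zero

  word : Fin (suc n) → Vec Z n
  word j = tabulate λ i → step (toℕ i ℕ.<? toℕ j)

  hit = Fin.pigeonhole (ℕ.n<1+n n) (col ∘ word)
  j₁ = proj₁ hit
  j₂ = proj₁ (proj₂ hit)
  j₁<j₂ : j₁ < j₂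
  j₁<j₂ = proj₁ (proj₂ (proj₂ hit))

  letter : ∀ {P Q : Set} → Dec P → Dec Q → Maybe Z
  letter (yes _) _       = just zero
  letter (no _)  (yes _) = nothing
  letter (no _)  (no _)  = just (suc zero)

  -- Moving exactly from `j₁` up to `j₂`, with `j₂` excluded, the line passes through both words:
  -- letter 1 gives `word j₁` and letter 0 gives `word j₂`.
  L : Line Z n
  L = tabulate λ i → letter (toℕ i ℕ.<? toℕ j₁) (toℕ i ℕ.<? toℕ j₂)

  j₁<n : toℕ j₁ ℕ.< n
  j₁<n = ℕ.<-≤-trans j₁<j₂ (ℕ.s≤s⁻¹ (Fin.toℕ<n j₂))

  c : Fin n
  c = fromℕ< j₁<n

  letter-moving : ∀ {P Q : Set} (p : Dec P) (q : Dec Q) → ¬ P → Q → letter p q ≡ nothing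
  letter-moving (yes p) _       ¬p _ = contradiction p ¬p
  letter-moving (no _)  (yes _) _  _ = refl
  letter-moving (no _)  (no ¬q) _  q = contradiction q ¬q

  L-c : lookup L c ≡ nothing
  L-c = trans (lookup∘tabulate _ c) (letter-moving _ _
    (ℕ.<-irrefl (Fin.toℕ-fromℕ< j₁<n))
    (subst (ℕ._< toℕ j₂) (sym (Fin.toℕ-fromℕ< j₁<n)) j₁<j₂))

  letter-one : ∀ {P Q : Set} (p : Dec P) (q : Dec Q) →
    maybe id (suc zero) (letter p q) ≡ step p
  letter-one (yes _) _       = refl
  letter-one (no _)  (yes _) = refl
  letter-one (no _)  (no _)  = refl

  letter-zero : ∀ {P Q : Set} (p : Dec P) (q : Dec Q) → (P → Q) →
    maybe id zero (letter p q) ≡ step q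
  letter-zero (yes p) (yes _) _   = refl
  letter-zero (yes p) (no ¬q) p→q = contradiction (p→q p) ¬q
  letter-zero (no _)  (yes _) _   = refl
  letter-zero (no _)  (no _)  _   = refl

  L-insensitive : col (L at zero) ≡ col (L at suc zero)
  L-insensitive = begin
    col (L at zero)      ≡⟨ cong col (trans (sym (tabulate-∘ _ _)) (tabulate-cong λ i →
                              letter-zero (toℕ i ℕ.<? toℕ j₁) (toℕ i ℕ.<? toℕ j₂) λ i<j₁ → ℕ.<-trans i<j₁ j₁<j₂)) ⟩
    col (word j₂)        ≡⟨ proj₂ (proj₂ (proj₂ hit)) ⟨
    col (word j₁)        ≡⟨ cong col (trans (sym (tabulate-∘ _ _)) (tabulate-cong λ i →
                              letter-one (toℕ i ℕ.<? toℕ j₁) (toℕ i ℕ.<? toℕ j₂))) ⟨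
    col (L at suc zero)  ∎
    where open ≡-Reasoning

-- Induction on the number of variables: a block of length `b` carries the new variable, and the
-- remaining `d` coordinates carry the others. In the tail a word is coloured by its table over all
-- letters of the new variable, which takes `K` colours.
shelah : ∀ k t n → Shelah k t n
shelah k t zero    = 0 , λ χ → [] , (λ ()) , λ { [] → refl }
shelah k t (suc n) = b + d , subspace
  where
  Z = Fin (suc (suc t))
  K = k ^ card (enumFin (suc (suc t)))
  d = proj₁ (shelah K t n)
  words = enumVec (enumFin (suc (suc t))) d
  -- `insensitive-line` wants as many coordinates as colours, and here a colour is a table over all
  -- tails of length `d`.
  b = k ^ card words

  subspace : (χ : Vec Z (b + d) → Fin k) →
    Σ (Vec (Z ⊎ Fin (suc n)) (b + d)) λ s →
      (∀ i → ∃ λ c → lookup s c ≡ inj₂ i) ×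
      (∀ u → χ (substitute id s u) ≡ χ (substitute id s (map (suc ∘ collapse) u)))
  subspace χ with insensitive-line {t} {b} (λ v → tableCode words (λ w → χ (v ++ w)))
  ... | L , (c₀ , L-c₀) , L-insensitive
      with proj₂ (shelah K t n) (λ w → tableCode (enumFin (suc (suc t))) (λ x → χ (L at x ++ w)))
  ... | s , s-covers , s-insensitive = s₀ ++ s₁ , covers , insensitive
    where
    s₀ : Vec (Z ⊎ Fin (suc n)) b
    s₀ = map (maybe inj₁ (inj₂ zero)) L

    s₁ : Vec (Z ⊎ Fin (suc n)) d
    s₁ = map (Sum.map₂ suc) s

    covers : ∀ i → ∃ λ c → lookup (s₀ ++ s₁) c ≡ inj₂ i
    covers zero = c₀ ↑ˡ d , trans (lookup-++ˡ s₀ s₁ c₀)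
      (trans (lookup-map c₀ _ L) (cong (maybe inj₁ (inj₂ zero)) L-c₀))
    covers (suc i) = let c , s-c = s-covers i in
      b ↑ʳ c , trans (lookup-++ʳ s₀ s₁ c)
        (trans (lookup-map c _ s) (cong (Sum.map₂ suc) s-c))

    substitute-++ : ∀ x u → substitute id (s₀ ++ s₁) (x ∷ u) ≡ L at x ++ substitute id s u
    substitute-++ x u = trans (map-++ _ s₀ s₁) (cong₂ _++_
      (trans (sym (map-∘ _ _ L)) (map-cong (λ { (just _) → refl ; nothing → refl }) L))
      (trans (sym (map-∘ _ _ s)) (map-cong (λ { (inj₁ _) → refl ; (inj₂ _) → refl }) s)))

    head-insensitive : ∀ x w → χ (L at x ++ w) ≡ χ (L at suc (collapse x) ++ w)
    head-insensitive zero    w = tableCode-injective words L-insensitive w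
    head-insensitive (suc x) w = refl

    tail-insensitive : ∀ x u → χ (L at x ++ substitute id s u) ≡
                               χ (L at x ++ substitute id s (map (suc ∘ collapse) u))
    tail-insensitive x u = tableCode-injective (enumFin (suc (suc t)))
      {f = λ x → χ (L at x ++ substitute id s u)} (s-insensitive u) x

    insensitive : ∀ u → χ (substitute id (s₀ ++ s₁) u) ≡
                        χ (substitute id (s₀ ++ s₁) (map (suc ∘ collapse) u))
    insensitive (x ∷ u) = begin
      χ (substitute id (s₀ ++ s₁) (x ∷ u))     ≡⟨ cong χ (substitute-++ x u) ⟩
      χ (L at x ++ substitute id s u)          ≡⟨ head-insensitive x _ ⟩
      χ (L at x′ ++ substitute id s u)         ≡⟨ tail-insensitive x′ u ⟩
      χ (L at x′ ++ substitute id s u′)        ≡⟨ cong χ (substitute-++ x′ u′) ⟨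
      χ (substitute id (s₀ ++ s₁) (x′ ∷ u′))   ∎
      where
      open ≡-Reasoning
      x′ = suc (collapse x)
      u′ = map (suc ∘ collapse) u

-- `L` is found over the letters other than 0. Extended to all letters inside the subspace, its
-- colour at `x` is that of `L` at `collapse x`, since 0 and 1 are not distinguished there.
halesJewett-step : HalesJewett k (suc t) → HalesJewett k (suc (suc t))
halesJewett-step {k} {t} (n₀ , hj) = d , line
  where
  d = proj₁ (shelah k t n₀)
  line : (χ : Vec (Fin (suc (suc t))) d → Fin k) →
    Σ (Line (Fin (suc (suc t))) d) λ L → Moving L × ∃ λ c → ∀ x → χ (L at x) ≡ c
  line χ with proj₂ (shelah k t n₀) χ
  ... | s , s-covers , s-insensitive
      with hj (λ w → χ (substitute id s (map suc w)))
  ... | L , (i , L-i) , c , L-mono =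
      substitute just s L⁺ , moving (s-covers i) , c , mono
    where
    L⁺ : Line (Fin (suc (suc t))) n₀
    L⁺ = map (Maybe.map suc) L

    moving : (∃ λ c → lookup s c ≡ inj₂ i) → Moving (substitute just s L⁺)
    moving (c , s-c) = c , trans (lookup-map c _ s) (trans (cong [ just , lookup L⁺ ] s-c)
      (trans (lookup-map i _ L) (cong (Maybe.map suc) L-i)))

    at-substitute : ∀ x → substitute just s L⁺ at x ≡ substitute id s (L⁺ at x)
    at-substitute x = trans (sym (map-∘ _ _ s)) (map-cong
      (λ { (inj₁ _) → refl ; (inj₂ v) → sym (lookup-map v _ L⁺) }) s)

    collapse-at : ∀ x → map (suc ∘ collapse) (L⁺ at x) ≡ map suc (L at collapse x)
    collapse-at x = begin
      map (suc ∘ collapse) (L⁺ at x)                               ≡⟨ map-∘ _ _ L⁺ ⟨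
      map (suc ∘ collapse ∘ maybe id x) L⁺                         ≡⟨ map-∘ _ _ L ⟨
      map (λ a → suc (collapse (maybe id x (Maybe.map suc a)))) L  ≡⟨ map-cong (λ { (just _) → refl ; nothing → refl }) L ⟩
      map (suc ∘ maybe id (collapse x)) L                          ≡⟨ map-∘ _ _ L ⟩
      map suc (L at collapse x)                                    ∎
      where open ≡-Reasoning

    mono : ∀ x → χ (substitute just s L⁺ at x) ≡ c
    mono x = begin
      χ (substitute just s L⁺ at x)                                ≡⟨ cong χ (at-substitute x) ⟩
      χ (substitute id s (L⁺ at x))                                ≡⟨ s-insensitive (L⁺ at x) ⟩
      χ (substitute id s (map (suc ∘ collapse) (L⁺ at x)))         ≡⟨ cong (χ ∘ substitute id s) (collapse-at x) ⟩
      χ (substitute id s (map suc (L at collapse x)))              ≡⟨ L-mono (collapse x) ⟩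
      c                                                            ∎
      where open ≡-Reasoning

halesJewett : Fin k → ∀ t → HalesJewett k t
-- An empty alphabet arises when there are no copies over a tuple; a colour must still be named,
-- hence `c₀`. Dimension 1 provides a moving coordinate.
halesJewett c₀ zero       = 1 , λ χ → nothing ∷ [] , (zero , refl) , c₀ , λ ()
halesJewett c₀ (suc zero) = 1 , λ χ → nothing ∷ [] , (zero , refl) , χ (zero ∷ []) , λ { zero → refl }
halesJewett c₀ (suc (suc t)) = halesJewett-step (halesJewett c₀ (suc t))

-- Partite systems

-- Equal to b exactly when all entries are b.  On a combinatorial line the fixed
-- coordinates contribute b, so the moving ones decide.
merge : Bool → Vec Bool n → Bool
merge b []       = b
merge b (x ∷ xs) = if b xor x then x else merge b xs

merge-constant : ∀ b (xs : Vec Bool n) → (∀ i → lookup xs i ≡ b) → merge b xs ≡ b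
merge-constant b     []       _  = refl
merge-constant true  (x ∷ xs) eq with x | eq zero
... | true | _  = merge-constant true xs (eq ∘ suc)
merge-constant false (x ∷ xs) eq with x | eq zero
... | false | _ = merge-constant false xs (eq ∘ suc)

merge-exception : ∀ b (xs : Vec Bool n) i → lookup xs i ≡ not b → merge b xs ≡ not b
merge-exception true  (false ∷ xs) _       _  = refl
merge-exception true  (true ∷ xs)  (suc i) eq = merge-exception true xs i eq
merge-exception false (true ∷ xs)  _       _  = refl
merge-exception false (false ∷ xs) (suc i) eq = merge-exception false xs i eq

merge-two-valued : ∀ b b′ (xs : Vec Bool n) → (∀ i → lookup xs i ≡ b ⊎ lookup xs i ≡ b′) →
  (∃ λ i → lookup xs i ≡ b′) → merge b xs ≡ b′
merge-two-valued true  false xs _  (i , eq) = merge-exception true xs i eq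
merge-two-valued false true  xs _  (i , eq) = merge-exception false xs i eq
merge-two-valued true  true  xs eq _        = merge-constant true xs ([ id , id ] ∘ eq)
merge-two-valued false false xs eq _        = merge-constant false xs ([ id , id ] ∘ eq)

-- A graph on the vertices Fin N × Fibre; only the values of bit p q with p < q matter.
record System (N : ℕ) : Set₁ where
  field
    Fibre : Set
    enum  : Enumeration Fibre
    bit   : Fin N → Fin N → Fibre → Fibre → Bool

open System

Embedding : System N → System N → Set
Embedding {N} S S′ = Σ (Fin N → Fibre S → Fibre S′) λ g →
  ∀ p q x y → p < q → bit S′ p q (g p x) (g q y) ≡ bit S p q x y

module Partite (k : ℕ) (c₀ : Fin k) {n N : ℕ} (a : Fin n → Fin n → Bool) where

  -- Monotonicity of `e` is built in, so a tuple that is not increasing has no copies over it, and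
  -- the construction can run over all tuples.
  Copy : (S : System N) → Vec (Fin N) n → Vec (Fibre S) n → Set
  Copy S e v = ∀ i j → i < j → (lookup e i < lookup e j) ×
    bit S (lookup e i) (lookup e j) (lookup v i) (lookup v j) ≡ a i j

  copy? : ∀ S e → Decidable (Copy S e)
  copy? S e v = Fin.all? λ i → Fin.all? λ j → (i <? j) →-dec
    ((lookup e i <? lookup e j) ×-dec (_ Bool.≟ a i j))

  copy-embed : ∀ S S′ (g : Embedding S S′) e v → Copy S e v → Copy S′ e (zipWith (proj₁ g) e v)
  copy-embed S S′ (g , g-bit) e v cp i j i<j with cp i j i<j
  ... | ei<ej , eq = ei<ej , trans
    (cong₂ (bit S′ _ _) (lookup-zipWith g i e v) (lookup-zipWith g j e v))
    (trans (g-bit _ _ _ _ ei<ej) eq)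

  Monochromatic : (S : System N) {F : Set} → (Fin N → Fibre S → F) →
    (Vec (Fin N) n → Vec F n → Fin k) → Vec (Fin N) n → Set
  Monochromatic S g Φ e = ∃ λ c → ∀ v → Copy S e v → Φ e (zipWith g e v) ≡ c

  -- Over the image of e the vertices of the new system are words over the old
  -- fibre, so that a word in the copies over e is read row by row as a copy;
  -- elsewhere a vertex is an old one with the coordinate at which it reads words.
  module Step (S : System N) (e : Vec (Fin N) n) where

    alphabet : List (Vec (Fibre S) n)
    alphabet = List.filter (copy? S e) (elements (enumVec (enum S) n))

    letter : Fin (length alphabet) → Vec (Fibre S) n
    letter = List.lookup alphabet

    letter-copy : ∀ l → Copy S e (letter l)
    letter-copy l = proj₂ (∈-filter⁻ (copy? S e) {xs = elements (enumVec (enum S) n)} (∈-lookup l))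

    copy-letter : ∀ v → Copy S e v → ∃ λ l → letter l ≡ v
    copy-letter v cp = index v∈ , sym (lookup-index v∈)
      where
      v∈ : v ∈ alphabet
      v∈ = ∈-filter⁺ (copy? S e) (complete (enumVec (enum S) n) v) cp

    hj = halesJewett c₀ (length alphabet)

    d : ℕ
    d = proj₁ hj

    Role : Fin N → Set
    Role p = ∃ λ i → lookup e i ≡ p

    role : ∀ p → Dec (Role p)
    role p = Fin.any? λ i → lookup e i ≟ p

    Fibre′ : Set
    Fibre′ = (Fin d × Fibre S) ⊎ Vec (Fibre S) d

    bit′ : ∀ {p q} → Dec (Role p) → Dec (Role q) → Fibre′ → Fibre′ → Bool
    bit′ {p} {q} _             _             (inj₁ (_ , x)) (inj₁ (_ , y)) = bit S p q x y
    bit′ {p} {q} _             _             (inj₁ (c , x)) (inj₂ w)       = bit S p q x (lookup w c)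
    bit′ {p} {q} _             _             (inj₂ w)       (inj₁ (c , y)) = bit S p q (lookup w c) y
    bit′ {p} {q} (yes (i , _)) (yes (j , _)) (inj₂ w)       (inj₂ w′)      = merge (a i j) (zipWith (bit S p q) w w′)
    -- A default value: `place` yields a word only over the image of `e`, so the embeddings never
    -- meet this case.
    bit′         _             _             (inj₂ _)       (inj₂ _)       = false

    system : System N
    system = record
      { Fibre = Fibre′
      ; enum  = enum⊎ (enum× (enumFin d) (enum S)) (enumVec (enum S) d)
      ; bit   = λ p q → bit′ (role p) (role q) }

    module _ (L : Line (Fin (length alphabet)) d) (L-moving : Moving L) where

      c* = proj₁ L-moving

      entry : Fin n → Fibre S → Maybe (Fin (length alphabet)) → Fibre S
      entry i x = maybe (λ l → lookup (letter l) i) x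

      -- The line spans a copy of `S`: over the image of `e` the vertex fills all moving coordinates
      -- and the letters fill the fixed ones; elsewhere the tag `c*` makes words be read at a moving
      -- coordinate, where the old vertex stands.
      place : ∀ {p} → Dec (Role p) → Fibre S → Fibre′
      place (yes (i , _)) x = inj₂ (map (entry i x) L)
      place (no _)        x = inj₁ (c* , x)

      read-c* : ∀ i x → lookup (map (entry i x) L) c* ≡ x
      read-c* i x = trans (lookup-map c* _ L) (cong (entry i x) (proj₂ L-moving))

      -- On a fixed coordinate both entries come from the same copy of `A`, on a moving one they are
      -- the original vertices. The existence of a letter makes `e` increasing, which recovers
      -- `i < j`.
      entry-bit : ∀ i j x y o → lookup e i < lookup e j →
        bit S (lookup e i) (lookup e j) (entry i x o) (entry j y o) ≡ a i j ⊎
        bit S (lookup e i) (lookup e j) (entry i x o) (entry j y o) ≡ bit S (lookup e i) (lookup e j) x y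
      entry-bit i j x y nothing  _     = inj₂ refl
      entry-bit i j x y (just l) ei<ej = inj₁ (proj₂ (letter-copy l i j
        (strictMono-cancel (λ i j i<j → proj₁ (letter-copy l i j i<j)) i j ei<ej)))

      place-bit : ∀ {p q} (P : Dec (Role p)) (Q : Dec (Role q)) x y → p < q →
        bit′ P Q (place P x) (place Q y) ≡ bit S p q x y
      place-bit (no _)        (no _)        x y _ = refl
      place-bit (no _)        (yes (j , _)) x y _ = cong (bit S _ _ x) (read-c* j y)
      place-bit (yes (i , _)) (no _)        x y _ = cong (λ z → bit S _ _ z y) (read-c* i x)
      place-bit (yes (i , refl)) (yes (j , refl)) x y p<q =
        merge-two-valued (a i j) _ bits two-valued (c* , at-c*)
        where
        β = bit S (lookup e i) (lookup e j)
        w = map (entry i x) L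
        w′ = map (entry j y) L
        bits = zipWith β w w′

        two-valued : ∀ s → lookup bits s ≡ a i j ⊎ lookup bits s ≡ β x y
        two-valued s = subst (λ b → b ≡ a i j ⊎ b ≡ β x y)
          (sym (trans (lookup-zipWith β s w w′)
            (cong₂ β (lookup-map s (entry i x) L) (lookup-map s (entry j y) L))))
          (entry-bit i j x y (lookup L s) p<q)

        at-c* : lookup bits c* ≡ β x y
        at-c* = trans (lookup-zipWith β c* w w′) (cong₂ β (read-c* i x) (read-c* j y))

      embedding : Embedding S system
      embedding = (λ p → place (role p)) , λ p q x y → place-bit (role p) (role q) x y

      rows : Vec (Fin (length alphabet)) d → Vec Fibre′ n
      rows w = tabulate λ i → inj₂ (map (λ l → lookup (letter l) i) w)

      -- `role` may report any index over the position; injectivity of `e` forces it to be `i`.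
      place-role : StrictMono (lookup e) → ∀ i x (P : Dec (Role (lookup e i))) →
        place P x ≡ inj₂ (map (entry i x) L)
      place-role e-mono i x (no ¬r) = contradiction (i , refl) ¬r
      place-role e-mono i x (yes (j , eq)) with strictMono-injective e-mono j i eq
      ... | refl = refl

      -- The link with Hales-Jewett: the letters are the copies over `e`, and their images are the
      -- points of the line read by rows.
      embed-letter : ∀ l → zipWith (proj₁ embedding) e (letter l) ≡ rows (L at l)
      embed-letter l = vec-ext λ i → begin
        lookup (zipWith (proj₁ embedding) e (letter l)) i          ≡⟨ lookup-zipWith _ i e (letter l) ⟩
        place (role (lookup e i)) (lookup (letter l) i)            ≡⟨ place-role (λ i j i<j → proj₁ (letter-copy l i j i<j)) i _ _ ⟩
        inj₂ (map (entry i (lookup (letter l) i)) L)               ≡⟨ cong inj₂ (trans (map-cong (λ { (just _) → refl ; nothing → refl }) L) (map-∘ _ _ L)) ⟩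
        inj₂ (map (λ l → lookup (letter l) i) (L at l))            ≡⟨ lookup∘tabulate _ i ⟨
        lookup (rows (L at l)) i                                   ∎
        where open ≡-Reasoning

    arrow : (Φ : Vec (Fin N) n → Vec (Fibre system) n → Fin k) →
      Σ (Embedding S system) λ g → Monochromatic S (proj₁ g) Φ e
    arrow Φ with proj₂ hj (λ w → Φ e (tabulate λ i → inj₂ (map (λ l → lookup (letter l) i) w)))
    ... | L , L-moving , c , L-mono = embedding L L-moving , c , mono
      where
      mono : ∀ v → Copy S e v → Φ e (zipWith (proj₁ (embedding L L-moving)) e v) ≡ c
      mono v cp with copy-letter v cp
      ... | l , refl = trans (cong (Φ e) (embed-letter L L-moving l)) (L-mono l)

  zipWith-∘ : ∀ {m} {F G H : Set} (g : Fin N → F → G) (g′ : Fin N → G → H) (e : Vec (Fin N) m) v →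
    zipWith (λ p → g′ p ∘ g p) e v ≡ zipWith g′ e (zipWith g e v)
  zipWith-∘ g g′ []      []      = refl
  zipWith-∘ g g′ (p ∷ e) (x ∷ v) = cong (g′ p (g p x) ∷_) (zipWith-∘ g g′ e v)

  -- The systems grow along the list, but a colouring is handled from the last one backwards:
  -- `arrow′` settles the later tuples, and the colouring pulled back along `g′` is then settled at
  -- `e`. The inner `g` preserves copies, so what was gained for the later tuples survives.
  partite : (S : System N) (es : List (Vec (Fin N) n)) → Σ (System N) λ S′ →
    (Φ : Vec (Fin N) n → Vec (Fibre S′) n → Fin k) →
    Σ (Embedding S S′) λ g → ∀ e → e ∈ es → Monochromatic S (proj₁ g) Φ e
  partite S []       = S , λ Φ → ((λ _ x → x) , λ _ _ _ _ _ → refl) , λ _ ()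
  partite S (e ∷ es) with partite (Step.system S e) es
  ... | S′ , arrow′ = S′ , arrow″
    where
    arrow″ : (Φ : Vec (Fin N) n → Vec (Fibre S′) n → Fin k) →
      Σ (Embedding S S′) λ g → ∀ e′ → e′ ∈ e ∷ es → Monochromatic S (proj₁ g) Φ e′
    arrow″ Φ with arrow′ Φ
    ... | (g′ , g′-bit) , mono′ with Step.arrow S e (λ e v → Φ e (zipWith g′ e v))
    ... | (g , g-bit) , c , mono =
          ((λ p → g′ p ∘ g p) , λ p q x y p<q → trans (g′-bit p q _ _ p<q) (g-bit p q x y p<q)) , both
      where
      both : ∀ e′ → e′ ∈ e ∷ es →
        ∃ λ c → ∀ v → Copy S e′ v → Φ e′ (zipWith (λ p → g′ p ∘ g p) e′ v) ≡ c
      both _  (here refl) = c , λ v cp → trans (cong (Φ e) (zipWith-∘ g g′ e v)) (mono v cp)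
      both e′ (there e′∈) = let c′ , eq = mono′ e′ e′∈ in
        c′ , λ v cp → trans (cong (Φ e′) (zipWith-∘ g g′ e′ v))
                            (eq _ (copy-embed S (Step.system S e) (g , g-bit) e′ v cp))

-- The parts of a structure in the age

least : {P : Fin n → Set} → Decidable P → ∀ i → P i → ∃ λ j → P j × (∀ x → P x → j ≤ x)
least {suc n} P? i pi with P? zero
... | yes p₀ = zero , p₀ , λ _ _ → z≤n
least P? zero    pi | no ¬p₀ = contradiction pi ¬p₀
least P? (suc i) pi | no ¬p₀ with least (P? ∘ suc) i pi
... | j , pj , j-least = suc j , pj ,
      λ { zero p₀ → contradiction p₀ ¬p₀ ; (suc x) px → s≤s (j-least x px) }

module Parts (A : Str) (A∈ : InAge A) where

  ⊥? : ∀ x y → Dec (A ⊢ x ⊥ y)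
  ⊥? x y = (E A x y Bool.≟ false) ×-dec (E A y x Bool.≟ false)

  ⊥-refl : ∀ x → A ⊢ x ⊥ x
  ⊥-refl x = proj₁ A∈ x , proj₁ A∈ x

  ⊥-sym : ∀ {x y} → A ⊢ x ⊥ y → A ⊢ y ⊥ x
  ⊥-sym (xy , yx) = yx , xy

  ⊥-trans : ∀ {x y z} → A ⊢ x ⊥ y → A ⊢ y ⊥ z → A ⊢ x ⊥ z
  ⊥-trans = proj₁ (proj₂ (proj₂ A∈)) _ _ _

  non-⊥-opposite : ∀ x y → ¬ A ⊢ x ⊥ y → E A y x ≡ not (E A x y)
  non-⊥-opposite x y ¬x⊥y with E A x y in xy | E A y x in yx
  ... | true  | true  = contradiction (trans (sym yx) (proj₁ (proj₂ A∈) x y xy)) λ ()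
  ... | true  | false = refl
  ... | false | true  = refl
  ... | false | false = contradiction (refl , refl) ¬x⊥y

  private
    first : ∀ x → ∃ λ y → A ⊢ y ⊥ x × (∀ z → A ⊢ z ⊥ x → y ≤ z)
    first x = least (λ y → ⊥? y x) x (⊥-refl x)

  rep : Fin (size A) → Fin (size A)
  rep x = proj₁ (first x)

  rep-⊥ : ∀ x → A ⊢ rep x ⊥ x
  rep-⊥ x = proj₁ (proj₂ (first x))

  rep-least : ∀ {x y} → A ⊢ y ⊥ x → rep x ≤ y
  rep-least = proj₂ (proj₂ (first _)) _

  rep-≤ : ∀ x → rep x ≤ x
  rep-≤ x = rep-least (⊥-refl x)

  rep-cong : ∀ {x y} → A ⊢ x ⊥ y → rep x ≡ rep y
  rep-cong x⊥y = Fin.≤-antisym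
    (rep-least (⊥-trans (rep-⊥ _) (⊥-sym x⊥y)))
    (rep-least (⊥-trans (rep-⊥ _) x⊥y))

  rep-cong⁻ : ∀ {x y} → rep x ≡ rep y → A ⊢ x ⊥ y
  rep-cong⁻ {x} {y} eq = ⊥-trans (⊥-sym (rep-⊥ x)) (subst (λ r → A ⊢ r ⊥ y) (sym eq) (rep-⊥ y))

  -- Convexity enters here: were `rep y` before `x`, the part of `y` would contain `x`.
  <-rep : ∀ {x y} → x < y → ¬ A ⊢ x ⊥ y → x < rep y
  <-rep {x} {y} x<y ¬x⊥y with Fin.<-cmp x (rep y)
  ... | tri< x<r _ _  = x<r
  ... | tri≈ _ refl _ = contradiction (rep-⊥ y) ¬x⊥y
  ... | tri> _ _ r<x  = contradiction
    (⊥-trans (⊥-sym (proj₂ (proj₂ (proj₂ A∈)) (rep y) x y r<x x<y (rep-⊥ y))) (rep-⊥ y)) ¬x⊥y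

-- Grids

combine-monoʳ-< : (i : Fin m) {j l : Fin n} → j < l → combine i j < combine i l
combine-monoʳ-< {n = n} i {j} {l} j<l =
  subst₂ ℕ._<_ (sym (Fin.toℕ-combine i j)) (sym (Fin.toℕ-combine i l)) (ℕ.+-monoʳ-< (n * toℕ i) j<l)

quotient-mono-≤ : ∀ n (x y : Fin (m * n)) → x ≤ y → quotient {m} n x ≤ quotient {m} n y
quotient-mono-≤ {m} n x y x≤y = ℕ.≮⇒≥ λ qy<qx → ℕ.<⇒≱
  (subst₂ _<_ (Fin.combine-remQuot {m} n y) (Fin.combine-remQuot {m} n x)
    (Fin.combine-monoˡ-< (remainder {m} n y) (remainder {m} n x) qy<qx)) x≤y

quotient-combine : (i : Fin m) (j : Fin n) → quotient n (combine i j) ≡ i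
quotient-combine i j = cong proj₁ (Fin.remQuot-combine i j)

remainder-combine : (i : Fin m) (j : Fin n) → remainder {m} n (combine i j) ≡ j
remainder-combine i j = cong proj₂ (Fin.remQuot-combine i j)

↑ˡ-mono-< : ∀ n {i j : Fin m} → i < j → i ↑ˡ n < j ↑ˡ n
↑ˡ-mono-< n {i} {j} i<j = subst₂ ℕ._<_ (sym (Fin.toℕ-↑ˡ i n)) (sym (Fin.toℕ-↑ˡ j n)) i<j

↑ʳ-mono-< : ∀ m {i j : Fin n} → i < j → m ↑ʳ i < m ↑ʳ j
↑ʳ-mono-< m {i} {j} i<j = subst₂ ℕ._<_ (sym (Fin.toℕ-↑ʳ m i)) (sym (Fin.toℕ-↑ʳ m j)) (ℕ.+-monoʳ-< m i<j)

↑ˡ<↑ʳ : (i : Fin m) (j : Fin n) → i ↑ˡ n < m ↑ʳ j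
↑ˡ<↑ʳ {m} {n} i j = subst₂ ℕ._<_ (sym (Fin.toℕ-↑ˡ i n)) (sym (Fin.toℕ-↑ʳ m j))
  (ℕ.<-≤-trans (Fin.toℕ<n i) (ℕ.m≤m+n m (toℕ j)))

data Side (m n : ℕ) : Fin (m + n) → Set where
  left  : ∀ i → Side m n (i ↑ˡ n)
  right : ∀ i → Side m n (m ↑ʳ i)

side : ∀ m n i → Side m n i
side m n i with splitAt m i in eq
... | inj₁ j = subst (Side m n) (Fin.splitAt⁻¹-↑ˡ eq) (left j)
... | inj₂ j = subst (Side m n) (Fin.splitAt⁻¹-↑ʳ eq) (right j)

-- Disjoint halves of the target make two increasing maps into one increasing tuple, the form that
-- Ramsey's theorem accepts.
_⊕_ : (Fin n → Fin m) → (Fin n → Fin m) → Vec (Fin (m + m)) (n + n)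
_⊕_ {m = m} f g = tabulate (λ i → f i ↑ˡ m) ++ tabulate (λ i → m ↑ʳ g i)

lookup-⊕ˡ : (f g : Fin n → Fin m) → ∀ i → lookup (f ⊕ g) (i ↑ˡ n) ≡ f i ↑ˡ m
lookup-⊕ˡ f g i = trans (lookup-++ˡ (tabulate _) (tabulate _) i) (lookup∘tabulate _ i)

lookup-⊕ʳ : (f g : Fin n → Fin m) → ∀ i → lookup (f ⊕ g) (n ↑ʳ i) ≡ m ↑ʳ g i
lookup-⊕ʳ {m = m} f g i = trans (lookup-++ʳ (tabulate λ i → f i ↑ˡ m) (tabulate _) i) (lookup∘tabulate _ i)

⊕-increasing : {f g : Fin n → Fin m} → StrictMono f → StrictMono g → Increasing (f ⊕ g)
⊕-increasing {n} {m} {f} {g} f-mono g-mono i j i<j with side n n i | side n n j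
... | left i  | left j  = subst₂ _<_ (sym (lookup-⊕ˡ f g i)) (sym (lookup-⊕ˡ f g j))
  (↑ˡ-mono-< m (f-mono i j (subst₂ ℕ._<_ (Fin.toℕ-↑ˡ i n) (Fin.toℕ-↑ˡ j n) i<j)))
... | left i  | right j = subst₂ _<_ (sym (lookup-⊕ˡ f g i)) (sym (lookup-⊕ʳ f g j)) (↑ˡ<↑ʳ (f i) (g j))
... | right i | left j  = contradiction i<j (ℕ.<-asym (↑ˡ<↑ʳ j i))
... | right i | right j = subst₂ _<_ (sym (lookup-⊕ʳ f g i)) (sym (lookup-⊕ʳ f g j))
  (↑ʳ-mono-< m (g-mono i j (ℕ.+-cancelˡ-< n _ _
    (subst₂ ℕ._<_ (Fin.toℕ-↑ʳ n i) (Fin.toℕ-↑ʳ n j) i<j))))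

-- The first half of H supplies the rows, indexed by the first element of each
-- part, the second half the columns.
module Grid (A : Str) (A∈ : InAge A) {T : ℕ} where
  open Parts A A∈

  grid : (Fin (size A + size A) → Fin T) → Fin (size A) → Fin (T * T)
  grid H x = combine (H (rep x ↑ˡ size A)) (H (size A ↑ʳ x))

  row-grid : ∀ H x → quotient T (grid H x) ≡ H (rep x ↑ˡ size A)
  row-grid H x = quotient-combine (H (rep x ↑ˡ size A)) _

  module _ {H : Fin (size A + size A) → Fin T} (H-mono : StrictMono H) where

    grid-mono : StrictMono (grid H)
    grid-mono x y x<y with ⊥? x y
    ... | no ¬x⊥y = Fin.combine-monoˡ-< _ _
      (H-mono _ _ (↑ˡ-mono-< (size A) (ℕ.≤-<-trans (rep-≤ x) (<-rep x<y ¬x⊥y))))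
    ... | yes x⊥y rewrite rep-cong x⊥y =
      combine-monoʳ-< (H (rep y ↑ˡ size A)) (H-mono _ _ (↑ʳ-mono-< (size A) x<y))

    row-≡ : ∀ {x y} → A ⊢ x ⊥ y → quotient T (grid H x) ≡ quotient T (grid H y)
    row-≡ {x} {y} x⊥y = trans (row-grid H x)
      (trans (cong (λ r → H (r ↑ˡ size A)) (rep-cong x⊥y)) (sym (row-grid H y)))

    row-≢ : ∀ {x y} → ¬ A ⊢ x ⊥ y → quotient T (grid H x) ≢ quotient T (grid H y)
    row-≢ {x} {y} ¬x⊥y eq = ¬x⊥y (rep-cong⁻ (Fin.↑ˡ-injective (size A) _ _
      (strictMono-injective H-mono _ _ (trans (sym (row-grid H x)) (trans eq (row-grid H y))))))

-- Copies of `A` in `B` as increasing tuples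

module _ {A B : Str} (A∈ : InAge A) (B∈ : InAge B) where
  private
    module A = Parts A A∈
    module B = Parts B B∈

  embedding-⊥ : ∀ h → IsEmb A B h → ∀ {x y} → A ⊢ x ⊥ y → B ⊢ lookup h x ⊥ lookup h y
  embedding-⊥ h (_ , h-edge) (xy , yx) = trans (sym (h-edge _ _)) xy , trans (sym (h-edge _ _)) yx

  embedding-⊥⁻ : ∀ h → IsEmb A B h → ∀ {x y} → B ⊢ lookup h x ⊥ lookup h y → A ⊢ x ⊥ y
  embedding-⊥⁻ h (_ , h-edge) (xy , yx) = trans (h-edge _ _) xy , trans (h-edge _ _) yx

  module _ (h : Vec (Fin (size B)) (size A)) (h-emb : IsEmb A B h) where

    -- Only the values at first elements of parts matter; the others fill the
    -- gaps so as to make the map increasing.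
    rowIndex : Fin (size A) → Fin (size B)
    rowIndex x with A.rep x ≟ x
    ... | yes _ = B.rep (lookup h x)
    ... | no _  = lookup h x

    rowIndex-≤ : ∀ x → rowIndex x ≤ lookup h x
    rowIndex-≤ x with A.rep x ≟ x
    ... | yes _ = B.rep-≤ (lookup h x)
    ... | no _  = ℕ.≤-refl

    -- With `rowIndex-≤` this gives monotonicity. If `y` is first in its part, then `x` is in
    -- another part, and the part of `lookup h y` starts after `lookup h x`.
    rowIndex-> : ∀ x y → x < y → lookup h x < rowIndex y
    rowIndex-> x y x<y with A.rep y ≟ y
    ... | no _  = proj₁ h-emb x y x<y
    ... | yes r = B.<-rep (proj₁ h-emb x y x<y) λ hx⊥hy →
      ℕ.<⇒≱ x<y (subst (_≤ x) r (A.rep-least (embedding-⊥⁻ h h-emb hx⊥hy)))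

    rowIndex-mono : StrictMono rowIndex
    rowIndex-mono x y x<y = ℕ.≤-<-trans (rowIndex-≤ x) (rowIndex-> x y x<y)

    rowIndex-rep : ∀ x → rowIndex (A.rep x) ≡ B.rep (lookup h x)
    rowIndex-rep x with A.rep (A.rep x) ≟ A.rep x
    ... | yes _ = B.rep-cong (embedding-⊥ h h-emb (A.rep-⊥ x))
    ... | no ≢r = contradiction (A.rep-cong (A.rep-⊥ x)) ≢r

    gridTuple : Vec (Fin (size B + size B)) (size A + size A)
    gridTuple = rowIndex ⊕ lookup h

    gridTuple-increasing : Increasing gridTuple
    gridTuple-increasing = ⊕-increasing rowIndex-mono (proj₁ h-emb)

    -- The position of a copy of `A` inside the gridded `B` is thus itself a grid of `A` spanned by
    -- a tuple in the range of `H`, where Ramsey's theorem controls the colour.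
    grid-gridTuple : ∀ {T} (H : Fin (size B + size B) → Fin T) x →
      Grid.grid A A∈ (lookup (map H gridTuple)) x ≡ Grid.grid B B∈ H (lookup h x)
    grid-gridTuple H x = cong₂ combine
      (trans (lookup-map _ H gridTuple) (cong H (trans (lookup-⊕ˡ rowIndex (lookup h) (A.rep x))
        (cong (_↑ˡ size B) (rowIndex-rep x)))))
      (trans (lookup-map _ H gridTuple) (cong H (lookup-⊕ʳ rowIndex (lookup h) x)))

-- The structure of a partite system over the grid, whose parts are the rows.
module Realise (T : ℕ) (S : System (T * T)) where

  M : ℕ
  M = card (enum S)

  row : Fin (T * T) → Fin T
  row = quotient {T} T

  position : Fin (T * T * M) → Fin (T * T)
  position = quotient {T * T} M

  point : Fin (T * T * M) → Fibre S
  point x = element (enum S) (remainder {T * T} M x)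

  -- One bit, taken with the smaller position first, orients each pair in different rows; so exactly
  -- one direction is an edge whatever the bits are.
  edge : Fin (T * T) → Fin (T * T) → Fibre S → Fibre S → Bool
  edge p q x y with row p ≟ row q | p <? q
  ... | yes _ | _     = false
  ... | no _  | yes _ = bit S p q x y
  ... | no _  | no _  = not (bit S q p y x)

  edge-same : ∀ p q x y → row p ≡ row q → edge p q x y ≡ false
  edge-same p q x y eq with row p ≟ row q | p <? q
  ... | yes _ | _ = refl
  ... | no ≢r | _ = contradiction eq ≢r

  edge-up : ∀ p q x y → row p ≢ row q → p < q → edge p q x y ≡ bit S p q x y
  edge-up p q x y ≢r p<q with row p ≟ row q | p <? q
  ... | yes eq | _      = contradiction eq ≢r
  ... | no _   | yes _  = refl
  ... | no _   | no p≮q = contradiction p<q p≮q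

  edge-down : ∀ p q x y → row p ≢ row q → q < p → edge p q x y ≡ not (bit S q p y x)
  edge-down p q x y ≢r q<p with row p ≟ row q | p <? q
  ... | yes eq | _       = contradiction eq ≢r
  ... | no _   | yes p<q = contradiction p<q (ℕ.<-asym q<p)
  ... | no _   | no _    = refl

  edge-opposite : ∀ p q x y → row p ≢ row q → edge q p y x ≡ not (edge p q x y)
  edge-opposite p q x y ≢r with Fin.<-cmp p q
  ... | tri< p<q _ _  = trans (edge-down q p y x (≢r ∘ sym) p<q)
                              (cong not (sym (edge-up p q x y ≢r p<q)))
  ... | tri≈ _ refl _ = contradiction refl ≢r
  ... | tri> _ _ q<p  = trans (edge-up q p y x (≢r ∘ sym) q<p)
    (trans (sym (Bool.not-involutive _)) (cong not (sym (edge-down p q x y ≢r q<p))))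

  C : Str
  C = record
    { size = T * T * M
    ; E    = λ x y → edge (position x) (position y) (point x) (point y) }

  same-row : ∀ x y → row (position x) ≡ row (position y) → C ⊢ x ⊥ y
  same-row x y eq = edge-same (position x) (position y) (point x) (point y) eq
                  , edge-same (position y) (position x) (point y) (point x) (sym eq)

  opposite : ∀ x y → row (position x) ≢ row (position y) → E C y x ≡ not (E C x y)
  opposite x y = edge-opposite (position x) (position y) (point x) (point y)

  ⊥-same-row : ∀ x y → C ⊢ x ⊥ y → row (position x) ≡ row (position y)
  ⊥-same-row x y (xy , yx) = decidable-stable (_ ≟ _) λ ≢r →
    contradiction (trans (sym yx) (trans (opposite x y ≢r) (cong not xy))) λ ()

  row-mono : ∀ x y → x < y → row (position x) ≤ row (position y)
  row-mono x y x<y = quotient-mono-≤ {T} T _ _ (quotient-mono-≤ {T * T} M x y (ℕ.<⇒≤ x<y))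

  C∈ : InAge C
  C∈ = (λ x → proj₁ (same-row x x refl))
     , asymmetric
     , (λ x y z x⊥y y⊥z → same-row x z (trans (⊥-same-row x y x⊥y) (⊥-same-row y z y⊥z)))
     , λ x y z x<y y<z x⊥z → same-row x y (Fin.≤-antisym (row-mono x y x<y)
         (subst (row (position y) ≤_) (sym (⊥-same-row x z x⊥z)) (row-mono y z y<z)))
    where
    asymmetric : ∀ x y → E C x y ≡ true → E C y x ≡ false
    asymmetric x y xy = trans (opposite x y λ eq →
      contradiction (trans (sym xy) (proj₁ (same-row x y eq))) λ ()) (cong not xy)

  vertex : Fin (T * T) → Fibre S → Fin (size C)
  vertex p x = combine p (code (enum S) x)

  position-vertex : ∀ p x → position (vertex p x) ≡ p
  position-vertex p x = quotient-combine p _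

  point-vertex : ∀ p x → point (vertex p x) ≡ x
  point-vertex p x = trans (cong (element (enum S)) (remainder-combine p (code (enum S) x)))
                           (element-code (enum S) x)

  E-vertex : ∀ p q x y → E C (vertex p x) (vertex q y) ≡ edge p q x y
  E-vertex p q x y = trans
    (cong₂ (λ p′ q′ → edge p′ q′ (point (vertex p x)) (point (vertex q y)))
      (position-vertex p x) (position-vertex q y))
    (cong₂ (edge p q) (point-vertex p x) (point-vertex q y))

-- The Ramsey structure for `A` and `B`

module Construction (k : ℕ) (c₀ : Fin k) (A B : Str) (A∈ : InAge A) (B∈ : InAge B) where

  T : ℕ
  T = proj₁ (ramsey k (size A + size A) (size B + size B))

  open Partite k c₀ {size A} {T * T} (E A)
  open Grid A A∈ {T} using () renaming (grid to gridA)
  open Grid B B∈ {T}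
  open Parts B B∈ using (⊥?; non-⊥-opposite; ⊥-refl; ⊥-sym)

  -- Every increasing map of B into the grid with the right rows lifts to a copy of B.
  S₀ : System (T * T)
  S₀ = record { Fibre = Fin (size B) ; enum = enumFin (size B) ; bit = λ _ _ → E B }

  positions : Enumeration (Vec (Fin (T * T)) (size A))
  positions = enumVec (enumFin (T * T)) (size A)

  S : System (T * T)
  S = proj₁ (partite S₀ (elements positions))

  open Realise T S

  Φ : (Vec (Fin (size C)) (size A) → Fin k) →
    Vec (Fin (T * T)) (size A) → Vec (Fibre S) (size A) → Fin k
  Φ χ e v = χ (zipWith vertex e v)

  module Colouring (χ : Vec (Fin (size C)) (size A) → Fin k) where

    partite-χ = proj₂ (partite S₀ (elements positions)) (Φ χ)

    g : Fin (T * T) → Fin (size B) → Fibre S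
    g = proj₁ (proj₁ partite-χ)

    g-bit : ∀ p q x y → p < q → bit S p q (g p x) (g q y) ≡ E B x y
    g-bit = proj₂ (proj₁ partite-χ)

    colour : Vec (Fin (T * T)) (size A) → Fin k
    colour e = proj₁ (proj₂ partite-χ e (complete positions e))

    colour-copy : ∀ e v → Copy S₀ e v → χ (zipWith vertex e (zipWith g e v)) ≡ colour e
    colour-copy e = proj₂ (proj₂ partite-χ e (complete positions e))

    -- A tuple `z` spans a position of `A` in the grid and receives the common colour of the copies
    -- over that position that come from `S₀`.
    homogeneous = proj₂ (ramsey k (size A + size A) (size B + size B))
      (λ z → colour (tabulate (gridA (lookup z))))

    H : Fin (size B + size B) → Fin T
    H = proj₁ homogeneous

    H-mono : StrictMono H
    H-mono = proj₁ (proj₂ homogeneous)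

    c : Fin k
    c = proj₁ (proj₂ (proj₂ homogeneous))

    H-colour : ∀ z → Increasing z → colour (tabulate (gridA (lookup (map H z)))) ≡ c
    H-colour = proj₂ (proj₂ (proj₂ homogeneous))

    b : Fin (size B) → Fin (T * T)
    b = grid H

    -- The diagonal lift: over its own grid position, `x` is represented by the fibre element `x` of
    -- `S₀`, carried into `S` by `g`.
    G : Fin (size B) → Fin (size C)
    G x = vertex (b x) (g (b x) x)

    G-up : ∀ x y → x < y → ¬ B ⊢ x ⊥ y → edge (b x) (b y) (g (b x) x) (g (b y) y) ≡ E B x y
    G-up x y x<y ¬x⊥y = trans
      (edge-up _ _ _ _ (row-≢ H-mono ¬x⊥y) (grid-mono H-mono x y x<y))
      (g-bit _ _ x y (grid-mono H-mono x y x<y))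

    G-edge : ∀ x y → edge (b x) (b y) (g (b x) x) (g (b y) y) ≡ E B x y
    G-edge x y with ⊥? x y
    ... | yes x⊥y = trans (edge-same _ _ _ _ (row-≡ H-mono x⊥y)) (sym (proj₁ x⊥y))
    ... | no ¬x⊥y with Fin.<-cmp x y
    ... | tri< x<y _ _  = G-up x y x<y ¬x⊥y
    ... | tri≈ _ refl _ = contradiction (⊥-refl x) ¬x⊥y
    ... | tri> _ _ y<x  = trans
      (edge-opposite _ _ _ _ (row-≢ H-mono (¬x⊥y ∘ ⊥-sym)))
      (trans (cong not (G-up y x y<x (¬x⊥y ∘ ⊥-sym))) (sym (non-⊥-opposite y x (¬x⊥y ∘ ⊥-sym))))

    G-mono : StrictMono G
    G-mono x y x<y = Fin.combine-monoˡ-< _ _ (grid-mono H-mono x y x<y)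

    G-emb : IsEmb B C (tabulate G)
    G-emb =
      (λ x y x<y → subst₂ _<_ (sym (lookup∘tabulate G x)) (sym (lookup∘tabulate G y)) (G-mono x y x<y)) ,
      (λ x y → sym (trans (cong₂ (E C) (lookup∘tabulate G x) (lookup∘tabulate G y))
        (trans (E-vertex (b x) (b y) _ _) (G-edge x y))))

    G-colour : ∀ h → IsEmb A B h → χ (map (lookup (tabulate G)) h) ≡ c
    G-colour h h-emb = begin
      χ (map (lookup (tabulate G)) h)                ≡⟨ cong χ (trans (map-cong (lookup∘tabulate G) h) (map-G h)) ⟩
      χ (zipWith vertex e (zipWith g e h))           ≡⟨ colour-copy e h copy ⟩
      colour e                                       ≡⟨ cong colour e-tuple ⟨
      colour (tabulate (gridA (lookup (map H z))))   ≡⟨ H-colour z (gridTuple-increasing A∈ B∈ h h-emb) ⟩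
      c                                              ∎
      where
      open ≡-Reasoning
      e = map b h
      z = gridTuple A∈ B∈ h h-emb

      map-G : (v : Vec (Fin (size B)) n) →
        map G v ≡ zipWith vertex (map b v) (zipWith g (map b v) v)
      map-G []      = refl
      map-G (x ∷ v) = cong (G x ∷_) (map-G v)

      copy : Copy S₀ e h
      copy i j i<j =
        subst₂ _<_ (sym (lookup-map i b h)) (sym (lookup-map j b h))
          (grid-mono H-mono _ _ (proj₁ h-emb i j i<j)) ,
        sym (proj₂ h-emb i j)

      e-tuple : tabulate (gridA (lookup (map H z))) ≡ e
      e-tuple = vec-ext λ x → trans (lookup∘tabulate _ x)
        (trans (grid-gridTuple A∈ B∈ h h-emb H x) (sym (lookup-map x b h)))

  result : Σ Str λ C → InAge C ×
    ((χ : Vec (Fin (size C)) (size A) → Fin k) →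
      Σ (Vec (Fin (size C)) (size B)) λ g → IsEmb B C g ×
        ∃ λ c → ∀ h → IsEmb A B h → χ (map (lookup g) h) ≡ c)
  result = C , C∈ , λ χ → let open Colouring χ in tabulate G , G-emb , c , G-colour

theorem8p5 : RamseyProperty InAge
theorem8p5 zero A B A∈ B∈ =
  -- A copy of `B` is required even when there are no colours, so it is taken from the construction
  -- for one colour. The equality of colours is then vacuous.
  let C , C∈ , arrow = Construction.result 1 zero A B A∈ B∈
      g , g-emb , _  = arrow (λ _ → zero)
  in C , C∈ , λ χ → g , g-emb , λ h _ _ _ → contradiction (χ (map (lookup g) h)) λ ()
theorem8p5 (suc k) A B A∈ B∈ =
  let C , C∈ , arrow = Construction.result (suc k) zero A B A∈ B∈
  in C , C∈ , λ χ → let g , g-emb , c , mono = arrow χ in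
       g , g-emb , λ h h′ h-emb h′-emb → trans (mono h h-emb) (sym (mono h′ h′-emb))
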